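{- Let $T$ be a thick tree with loops with vertex set $V$ and sink $s\in V$, let $V_0=V\setminus\{s\}$, let $G$ be its sandpile group, and let $\mathbf e^T\in G$ be the identity element of $G$. Let $\mathbf u\in\mathbb{Z}_{\ge0}^{V_0}$ be any configuration. Then the associated recurrent configuration $\sigma(\mathbf u+\mathbf e^T)$ is given recursively, for $j\in V_0$, by $$\sigma(\mathbf u+\mathbf e^T)_j=\begin{cases} u_j-\lfloor u_j/e_{j,p(j)}\rfloor\, e_{j,p(j)}, & \text{if } j\text{ is a leaf},\\ u_j+\lambda_j e_{j,p(j)}+\sum_{i\succ j}\bigl(u_i-\sigma(\mathbf u+\mathbf e^T)_i\bigr), & \text{otherwise},\end{cases}$$ where $$\lambda_j=\left\lfloor\frac{\deg(j)-u_j-\sum_{i\succ j}\bigl(u_i-\sigma(\mathbf u+\mathbf e^T)_i\bigr)-1}{e_{j,p(j)}}\right\rfloor.$$ Moreover, if $\sigma(\mathbf u)$ is already recurrent, then the same formulas hold with $\sigma(\mathbf u+\mathbf e^T)$ replaced throughout by $\sigma(\mathbf u)$.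
   Context: Graphs are finite, connected, undirected, with multiple edges and loops allowed. For vertices $i,j$, $e_{i,j}$ is the number of edges with endpoint set $\{i,j\}$ (so $e_{i,i}$ is the number of loops at $i$), and $\deg(i)=\sum_{j\in V}e_{i,j}$, so each loop is counted once. A distinguished vertex $s\in V$ is called the sink; $V_0=V\setminus\{s\}$. Thick tree with loops: a graph $T$ such that the simple graph $T'$ obtained by deleting all loops and reducing all nonzero edge multiplicities to $1$ is a tree. A leaf is a vertex $i\ne s$ of degree $1$ in $T'$. For $i,j\in V$, write $i\succeq j$ if $j$ lies on the unique path in $T'$ from $i$ to $s$ (endpoints included), and $i\succ j$ if moreover $i\ne j$. For $j\in V_0$, the parent $p(j)$ is the neighbour of $j$ in $T'$ lying on the path from $j$ to $s$ (i.e. $p(j)$ is adjacent to $j$ and $j\succ p(j)$). Sandpile model: a configuration is a vector $\mathbf u\in\mathbb{Z}_{\ge0}^{V_0}$. A vertex $i\in V_0$ is stable for $\mathbf u$ if $u_i<\deg(i)$, otherwise unstable; $\mathbf u$ is stable if all vertices of $V_0$ are. Toppling an unstable vertex $i$ replaces $u_i$ by $u_i-\deg(i)+e_{i,i}$ and $u_j$ by $u_j+e_{i,j}$ for each $j\in V_0$, $j\ne i$. Repeatedly toppling unstable vertices leads, in finitely many steps, to a stable configuration that is independent of the choices, denoted $\sigma(\mathbf u)$ (the stabilization). Put $\mathbf u\oplus\mathbf v=\sigma(\mathbf u+\mathbf v)$. A configuration $\mathbf u$ is recurrent if for every configuration $\mathbf v$ there is a configuration $\mathbf w$ with $\mathbf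 v\oplus\mathbf w=\mathbf u$. The set $G$ of recurrent configurations is an abelian group under $\oplus$ (known), called the sandpile group.
   Formalization: The leaf formula is claimed only for leaves without loops; a leaf carrying loops is covered by the "otherwise" formula instead, since the leaf formula fails there (e.g. one edge to the sink and one loop: the only recurrent value is 1, but the formula gives 0). -}

module Defs where

open import Data.Bool.Base using (if_then_else_)
open import Data.Fin.Base using (Fin; punchIn)
open import Data.Fin.Properties using (_≟_; any?; punchInᵢ≢i; injective⇒≤)
open import Data.Integer.Base as ℤ using (ℤ; +_; 0ℤ; 1ℤ; _/ℕ_)
import Data.Integer.Properties as ℤₚ
open import Data.List.Base as List using (List; []; _∷_; length; filter; allFin)
open import Data.List.Membership.DecPropositional using () renaming (_∈?_ to mem?)
open import Data.List.Membership.Propositional using (_∈_)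
open import Data.List.Membership.Propositional.Properties using (∈-lookup)
open import Data.List.Relation.Unary.All as All using (All; []; _∷_)
open import Data.List.Relation.Unary.All.Properties using (¬Any⇒All¬)
open import Data.List.Relation.Unary.AllPairs using ([]; _∷_)
open import Data.List.Relation.Unary.Any using (here; there)
open import Data.List.Relation.Unary.Unique.Propositional using (Unique)
open import Data.List.Relation.Unary.Unique.DecPropositional using (unique?)
open import Data.Nat.Base as ℕ using (ℕ; suc; zero; _+_; _∸_; _≤_; _<_; z≤n; s≤s; NonZero; ≢-nonZero)
import Data.Nat.DivMod as ℕ using (_/_)
import Data.Nat.Properties as ℕₚ
open import Data.Product using (Σ; Σ-syntax; ∃; ∃-syntax; _×_; _,_; proj₁; proj₂)
open import Data.Vec.Base using (Vec; lookup; tabulate; zipWith)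
open import Relation.Binary.Construct.Closure.ReflexiveTransitive using (Star; ε; _◅_)
open import Relation.Binary.PropositionalEquality
open import Relation.Nullary using (¬_; Dec; yes; no; does; contradiction; _×-dec_; ¬?)
import Relation.Nullary.Decidable as Dec

import Algebra.Properties.CommutativeMonoid.Sum ℕₚ.+-0-commutativeMonoid as Sumℕ
import Algebra.Properties.CommutativeMonoid.Sum ℤₚ.+-0-commutativeMonoid as Sumℤ

-- A multigraph is given by its edge multiplicities; e i i is the number of
-- loops at i.  The vertex set is V = Fin (suc m), and V₀ = V ∖ {s} is
-- represented by Fin m through the bijection ι = punchIn s.
record SinkedGraph (m : ℕ) : Set where
  field
    e     : Fin (suc m) → Fin (suc m) → ℕ
    e-sym : ∀ i j → e i j ≡ e j i
    s     : Fin (suc m)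

  V : Set
  V = Fin (suc m)

  V₀ : Set
  V₀ = Fin m

  ι : V₀ → V
  ι = punchIn s

  deg : V → ℕ
  deg i = Sumℕ.sum (e i)

  -- Adjacency in T′.
  Adj : V → V → Set
  Adj i j = i ≢ j × e i j ≢ 0

  Adj? : ∀ i j → Dec (Adj i j)
  Adj? i j = ¬? (i ≟ j) ×-dec ¬? (e i j ℕₚ.≟ 0)

  Walk : V → V → Set
  Walk = Star Adj

  vertices : ∀ {i j} → Walk i j → List V
  vertices {i} ε       = i ∷ []
  vertices {i} (_ ◅ w) = i ∷ vertices w

  IsPath : ∀ {i j} → Walk i j → Set
  IsPath w = Unique (vertices w)

  Connected : Set
  Connected = ∀ i j → Walk i j

  -- A cycle is a path on at least three vertices whose ends are adjacent.
  Acyclic : Set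
  Acyclic = ∀ {i j} (w : Walk i j) → IsPath w → 3 ≤ length (vertices w) → ¬ Adj j i

  infix 4 _⪰_ _≻_ _≻?_

  _⪰_ : V → V → Set
  i ⪰ j = Σ[ w ∈ Walk i s ] (IsPath w × j ∈ vertices w)

  _≻_ : V → V → Set
  i ≻ j = i ⪰ j × i ≢ j

  IsLeaf : V₀ → Set
  IsLeaf j = length (filter (Adj? (ι j)) (allFin (suc m))) ≡ 1

  IsLoopless : V₀ → Set
  IsLoopless j = e (ι j) (ι j) ≡ 0

  private
    search : ∀ k i (Q : List V → Set) → (∀ xs → Dec (Q xs)) →
             Dec (Σ[ w ∈ Walk i s ] (length (vertices w) ≤ k × Q (vertices w)))
    search zero i Q Q? = no λ { (ε , () , _) ; (_ ◅ _ , () , _) }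
    search (suc k) i Q Q? = Dec.map′ to from (stop? Dec.⊎-dec step?)
      where
      open import Data.Sum.Base using (_⊎_; inj₁; inj₂)
      Stop Step : Set
      Stop = i ≡ s × Q (i ∷ [])
      Step = ∃ λ j → Adj i j ×
               Σ[ w ∈ Walk j s ] (length (vertices w) ≤ k × Q (i ∷ vertices w))
      stop? : Dec Stop
      stop? = (i ≟ s) ×-dec Q? (i ∷ [])
      step? : Dec Step
      step? = any? λ j → Adj? i j ×-dec search k j (λ xs → Q (i ∷ xs)) (λ xs → Q? (i ∷ xs))
      to : Stop ⊎ Step → Σ[ w ∈ Walk i s ] (length (vertices w) ≤ suc k × Q (vertices w))
      to (inj₁ (refl , q))            = ε , s≤s z≤n , q
      to (inj₂ (j , a , w , l , q)) = a ◅ w , s≤s l , q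
      from : Σ[ w ∈ Walk i s ] (length (vertices w) ≤ suc k × Q (vertices w)) → Stop ⊎ Step
      from (ε , _ , q)           = inj₁ (refl , q)
      from (a ◅ w , s≤s l , q) = inj₂ (_ , a , w , l , q)

    unique-lookup : ∀ {xs : List V} → Unique xs → ∀ {a b} →
                    List.lookup xs a ≡ List.lookup xs b → a ≡ b
    unique-lookup (_ ∷ _) {Fin.zero} {Fin.zero} _ = refl
    unique-lookup (x≢ ∷ _) {Fin.zero} {Fin.suc b} eq =
      contradiction eq (All.lookup x≢ (∈-lookup b))
    unique-lookup (x≢ ∷ _) {Fin.suc a} {Fin.zero} eq =
      contradiction (sym eq) (All.lookup x≢ (∈-lookup a))
    unique-lookup (_ ∷ u) {Fin.suc a} {Fin.suc b} eq = cong Fin.suc (unique-lookup u eq)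

    suffix : ∀ {i j k} (w : Walk j k) → IsPath w → i ∈ vertices w →
             Σ[ w′ ∈ Walk i k ] IsPath w′
    suffix ε       u       (here refl) = ε , u
    suffix (a ◅ w) u       (here refl) = a ◅ w , u
    suffix (_ ◅ w) (_ ∷ u) (there i∈) = suffix w u i∈

    toPath : ∀ {i j} → Walk i j → Σ[ w ∈ Walk i j ] IsPath w
    toPath ε = ε , [] ∷ []
    toPath {i} (a ◅ w) with toPath w
    ... | w′ , u with mem? _≟_ i (vertices w′)
    ...   | yes i∈ = suffix w′ u i∈
    ...   | no  i∉ = a ◅ w′ , ¬Any⇒All¬ _ i∉ ∷ u

    source∈ : ∀ {i j} (w : Walk i j) → i ∈ vertices w
    source∈ ε       = here refl
    source∈ (_ ◅ _) = here refl

  _⪰?_ : ∀ i j → Dec (i ⪰ j)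
  i ⪰? j = Dec.map′
    (λ (w , _ , u , j∈) → w , u , j∈)
    (λ (w , u , j∈) → w , injective⇒≤ (unique-lookup u) , u , j∈)
    (search (suc m) i (λ xs → Unique xs × j ∈ xs) (λ xs → unique? _≟_ xs ×-dec mem? _≟_ j xs))

  _≻?_ : ∀ i j → Dec (i ≻ j)
  i ≻? j = (i ⪰? j) ×-dec ¬? (i ≟ j)

  IsParent : V₀ → V → Set
  IsParent j p = Adj (ι j) p × ι j ≻ p

  hasParent : Connected → ∀ j → ∃ (IsParent j)
  hasParent conn j with punchInᵢ≢i s j | toPath (conn (ι j) s)
  ... | ιj≢s | w , u = go ιj≢s w u
    where
    go : ∀ {v} → v ≢ s → (w : Walk v s) → IsPath w → ∃ λ p → Adj v p × v ≻ p
    go v≢s ε       u = contradiction refl v≢s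
    go v≢s (a ◅ w) u = _ , a , (a ◅ w , u , there (source∈ w)) , proj₁ a

  Config : Set
  Config = Vec ℕ m

  infixl 6 _⊞_
  infix  4 _⟶_ _⟶*_ _↝_

  _⊞_ : Config → Config → Config
  _⊞_ = zipWith _+_

  StableAt : Config → V₀ → Set
  StableAt u i = lookup u i < deg (ι i)

  Stable : Config → Set
  Stable u = ∀ i → StableAt u i

  -- The subtraction is exact whenever i is unstable.
  topple : V₀ → Config → Config
  topple i u = tabulate λ j →
    if does (j ≟ i) then lookup u i ∸ deg (ι i) + e (ι i) (ι i)
                    else lookup u j + e (ι i) (ι j)

  _⟶_ : Config → Config → Set
  u ⟶ v = ∃[ i ] (¬ StableAt u i × v ≡ topple i u)

  _⟶*_ : Config → Config → Set
  _⟶*_ = Star _⟶_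

  -- u ↝ c says σ(u) = c.  The stabilization is kept as a relation, so that it
  -- does not depend on a chosen toppling order.
  _↝_ : Config → Config → Set
  u ↝ c = u ⟶* c × Stable c

  Recurrent : Config → Set
  Recurrent u = ∀ v → ∃[ w ] (v ⊞ w ↝ u)

  IsSandpileIdentity : Config → Set
  IsSandpileIdentity 𝐞 =
    Recurrent 𝐞 × (∀ v → Recurrent v → (𝐞 ⊞ v ↝ v) × (v ⊞ 𝐞 ↝ v))

record ThickTree (m : ℕ) : Set where
  field
    graph : SinkedGraph m

  open SinkedGraph graph public

  field
    connected : Connected
    acyclic   : Acyclic

  parent : V₀ → V
  parent j = proj₁ (hasParent connected j)

  -- e_{j,p(j)}
  eₚ : V₀ → ℕ
  eₚ j = e (ι j) (parent j)

  eₚ-nonZero : ∀ j → NonZero (eₚ j)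
  eₚ-nonZero j = ≢-nonZero (proj₂ (proj₁ (proj₂ (hasParent connected j))))

  -- Σ_{i ≻ j} (u_i − c_i); no i ≻ j is the sink, so i ranges over V₀.
  excess : Config → Config → V₀ → ℤ
  excess u c j = Sumℤ.sum λ i →
    if does (ι i ≻? ι j) then + lookup u i ℤ.- + lookup c i else 0ℤ

  -- _/ℕ_ rounds towards −∞.
  λ′ : Config → Config → V₀ → ℤ
  λ′ u c j =
    (+ deg (ι j) ℤ.- + lookup u j ℤ.- excess u c j ℤ.- 1ℤ) /ℕ eₚ j
    where instance _ = eₚ-nonZero j

  LeafFormula : Config → Config → V₀ → Set
  LeafFormula u c j =
    + lookup c j ≡ + lookup u j ℤ.- + (lookup u j ℕ./ eₚ j) ℤ.* + eₚ j
    where instance _ = eₚ-nonZero j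

  NonLeafFormula : Config → Config → V₀ → Set
  NonLeafFormula u c j =
    + lookup c j ≡ + lookup u j ℤ.+ λ′ u c j ℤ.* + eₚ j ℤ.+ excess u c j

  -- The leaf case is confined to leaves without loops, and a leaf with loops
  -- falls under the second case: with e_{j,j} loops the recurrent values at a
  -- leaf j are e_{j,j}, …, deg(j) − 1, whereas u_j − ⌊u_j/e_{j,p(j)}⌋ e_{j,p(j)}
  -- lies in 0, …, e_{j,p(j)} − 1.  (For one sink edge and one loop at j, the
  -- only recurrent value is 1 but the leaf expression is always 0.)
  RecursiveFormula : Config → Config → Set
  RecursiveFormula u c = ∀ j →
    (IsLeaf j × IsLoopless j → LeafFormula u c j) ×
    (¬ (IsLeaf j × IsLoopless j) → NonLeafFormula u c j)

{-# OPTIONS --safe #-}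
-- If u topples to c, then u − c is the graph Laplacian of an integer vector N
-- with N_s = 0; adding the identity 𝐞 does not matter, since 𝐞 ⊕ 𝐞 = 𝐞 makes 𝐞
-- a Laplacian too.  Summed over the subtree {i ⪰ j}, the Laplacian telescopes
-- to the flow through the one edge class leaving it:
--   u_j − c_j + Σ_{i ≻ j} (u_i − c_i) = e_{j,p(j)} (N_j − N_{p(j)}).
-- So c_j is known modulo e_{j,p(j)}.  A recurrent configuration has no
-- forbidden subconfiguration, a property preserved by legal topplings; applied
-- to the subtree {i ⪰ j}, it gives deg(j) − e_{j,p(j)} ≤ c_j < deg(j), which
-- pins c_j down.

module Submission where

open import Defs
open import Data.Nat using (ℕ)
open import Data.Product using (_×_)

open import Algebra.Bundles using (CommutativeMonoid)
open import Data.Bool.Base using (Bool; true; false; if_then_else_; _∧_; not)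
import Data.Bool.Properties as Bool
open import Data.Fin.Base using (Fin; zero; suc; punchIn; punchOut)
open import Data.Fin.Properties using (_≟_; any?; punchIn-injective; punchInᵢ≢i; punchIn-punchOut)
open import Data.Integer.Base as ℤ using (ℤ; +_; 0ℤ; 1ℤ; _/ℕ_)
open import Data.Integer.DivMod using ([n/ℕd]*d≤n; n<s[n/ℕd]*d)
import Data.Integer.Properties as ℤₚ
open import Data.Integer.Tactic.RingSolver using (solve-∀)
open import Data.List.Base using (List; []; _∷_; length; allFin)
import Data.List.Membership.DecPropositional as DecMembership
open import Data.List.Membership.Propositional using (_∈_; _∉_)
open import Data.List.Membership.Propositional.Properties using (∈-allFin; ∈-filter⁺)
open import Data.List.Relation.Binary.Subset.Propositional using (_⊆_)
open import Data.List.Relation.Unary.All as All using ([])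
open import Data.List.Relation.Unary.All.Properties using (All¬⇒¬Any; ¬Any⇒All¬)
open import Data.List.Relation.Unary.AllPairs using ([]; _∷_)
open import Data.List.Relation.Unary.Any using (here; there)
open import Data.Nat.Base as ℕ using (suc; _+_; _∸_; _≤_; _<_; z≤n; s≤s; NonZero)
import Data.Nat.Properties as ℕₚ
import Data.Nat.Tactic.RingSolver as ℕ-Solver
open import Data.Product using (∃-syntax; Σ-syntax; _,_; proj₁; proj₂)
open import Data.Sum.Base using (_⊎_; inj₁; inj₂)
open import Data.Vec.Base using (lookup; tabulate)
open import Data.Vec.Properties using
  (lookup∘tabulate; lookup-zipWith; tabulate∘lookup; tabulate-cong; zipWith-assoc; zipWith-comm)
open import Function.Base using (_∘_)
open import Relation.Binary.Construct.Closure.ReflexiveTransitive using (Star; ε; _◅_; _◅◅_; reverse)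
open import Relation.Binary.PropositionalEquality
open import Relation.Nullary using (¬_; Dec; yes; no; does; contradiction)
open import Relation.Nullary.Decidable using (dec-true; dec-false)

import Algebra.Properties.CommutativeMonoid.Sum as Sum
import Algebra.Properties.CommutativeMonoid.Sum ℕₚ.+-0-commutativeMonoid as Sumℕ
import Algebra.Properties.CommutativeMonoid.Sum ℤₚ.+-0-commutativeMonoid as Sumℤ

-- Finite sums

module _ {a ℓ} (M : CommutativeMonoid a ℓ) where
  open CommutativeMonoid M renaming (ε to 𝟘; trans to ≈-trans)
  open Sum M

  sum-zero : ∀ {n} {t : Fin n → Carrier} → (∀ i → t i ≈ 𝟘) → sum t ≈ 𝟘
  sum-zero {n} t≈0 = ≈-trans (sum-cong-≋ t≈0) (sum-replicate-zero n)

  sum-single : ∀ {n} (t : Fin n → Carrier) j → (∀ i → i ≢ j → t i ≈ 𝟘) → sum t ≈ t j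
  sum-single {suc n} t j t≈0 =
    ≈-trans (sum-remove t)
      (≈-trans (∙-congˡ (sum-zero λ i → t≈0 (punchIn j i) (punchInᵢ≢i j i)))
        (identityʳ (t j)))

sumℕ-single : ∀ {n} (t : Fin n → ℕ) j → (∀ i → i ≢ j → t i ≡ 0) → Sumℕ.sum t ≡ t j
sumℕ-single = sum-single ℕₚ.+-0-commutativeMonoid

sumℤ-single : ∀ {n} (t : Fin n → ℤ) j → (∀ i → i ≢ j → t i ≡ 0ℤ) → Sumℤ.sum t ≡ t j
sumℤ-single = sum-single ℤₚ.+-0-commutativeMonoid

sumℕ-split : ∀ {n} {f : Fin n → ℕ} (g h : Fin n → ℕ) → (∀ i → f i ≡ g i + h i) →
             Sumℕ.sum f ≡ Sumℕ.sum g + Sumℕ.sum h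
sumℕ-split g h eq = trans (Sumℕ.sum-cong-≗ eq) (Sumℕ.∑-distrib-+ g h)

sumℤ-split : ∀ {n} {f : Fin n → ℤ} (g h : Fin n → ℤ) → (∀ i → f i ≡ g i ℤ.+ h i) →
             Sumℤ.sum f ≡ Sumℤ.sum g ℤ.+ Sumℤ.sum h
sumℤ-split g h eq = trans (Sumℤ.sum-cong-≗ eq) (Sumℤ.∑-distrib-+ g h)

sumℤ-neg : ∀ {n} (f : Fin n → ℤ) → Sumℤ.sum (λ i → ℤ.- f i) ≡ ℤ.- Sumℤ.sum f
sumℤ-neg {ℕ.zero} f = refl
sumℤ-neg {suc n}  f =
  trans (cong (ℤ._+_ (ℤ.- f zero)) (sumℤ-neg (f ∘ suc))) (sym (ℤₚ.neg-distrib-+ (f zero) _))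

sumℤ-pos : ∀ {n} (f : Fin n → ℕ) → Sumℤ.sum (λ i → + f i) ≡ + Sumℕ.sum f
sumℤ-pos {ℕ.zero} f = refl
sumℤ-pos {suc n}  f = cong (ℤ._+_ (+ f zero)) (sumℤ-pos (f ∘ suc))

i≡-i⇒i≡0 : ∀ {i} → i ≡ ℤ.- i → i ≡ 0ℤ
i≡-i⇒i≡0 {ℤ.+0} _ = refl

-- Exchanging the two summations turns the double sum into its own negative.
sumℤ-antisym : ∀ {n} (f : Fin n → Fin n → ℤ) → (∀ i k → f i k ≡ ℤ.- f k i) →
               Sumℤ.sum (λ i → Sumℤ.sum (f i)) ≡ 0ℤ
sumℤ-antisym f anti = i≡-i⇒i≡0 (begin
  Sumℤ.sum (λ i → Sumℤ.sum (f i))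
    ≡⟨ Sumℤ.sum-cong-≗ (λ i → trans (Sumℤ.sum-cong-≗ (anti i)) (sumℤ-neg (λ k → f k i))) ⟩
  Sumℤ.sum (λ i → ℤ.- Sumℤ.sum (λ k → f k i))
    ≡⟨ sumℤ-neg (λ i → Sumℤ.sum (λ k → f k i)) ⟩
  ℤ.- Sumℤ.sum (λ i → Sumℤ.sum (λ k → f k i))
    ≡⟨ cong ℤ.-_ (Sumℤ.∑-comm (λ i k → f k i)) ⟩
  ℤ.- Sumℤ.sum (λ k → Sumℤ.sum (f k)) ∎)
  where open ≡-Reasoning

-- The floor satisfies `(n /ℕ d) * d ≤ n < suc (n /ℕ d) * d`. If `q` differed from it, the gap of at
-- least one, multiplied by `d`, would contradict these bounds together with `0 ≤ r < d`.
/ℕ-unique : ∀ n q r d .{{_ : NonZero d}} → r < d → n ≡ + r ℤ.+ q ℤ.* + d → n /ℕ d ≡ q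
/ℕ-unique n q r d r<d refl = ℤₚ.≤-antisym
  (ℤₚ.≮⇒≥ λ q<n/d → ℤₚ.<⇒≱ n<sq*d (ℤₚ.≤-trans (scale q<n/d) ([n/ℕd]*d≤n n d)))
  (ℤₚ.≮⇒≥ λ n/d<q → ℤₚ.<⇒≱ (n<s[n/ℕd]*d n d) (ℤₚ.≤-trans (scale n/d<q) (ℤₚ.i≤j+i _ (+ r))))
  where
  scale : ∀ {i j} → i ℤ.< j → ℤ.suc i ℤ.* + d ℤ.≤ j ℤ.* + d
  scale i<j = ℤₚ.*-monoʳ-≤-nonNeg (+ d) (ℤₚ.i<j⇒suc[i]≤j i<j)
  n<sq*d : + r ℤ.+ q ℤ.* + d ℤ.< ℤ.suc q ℤ.* + d
  n<sq*d = subst (+ r ℤ.+ q ℤ.* + d ℤ.<_) (sym (ℤₚ.suc-* q (+ d)))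
             (ℤₚ.+-monoˡ-< (q ℤ.* + d) (ℤ.+<+ r<d))

length≡1⇒unique : ∀ {a} {A : Set a} {xs : List A} {x y} → length xs ≡ 1 → x ∈ xs → y ∈ xs → x ≡ y
length≡1⇒unique {xs = _ ∷ []} _ (here refl) (here refl) = refl

-- Toppling and recurrence on an arbitrary graph with a sink.

module Toppling {m : ℕ} (G : SinkedGraph m) where
  open SinkedGraph G

  ι≢s : ∀ i → ι i ≢ s
  ι≢s = punchInᵢ≢i s

  sink-or-ι : ∀ k → k ≡ s ⊎ ∃[ i ] k ≡ ι i
  sink-or-ι k with s ≟ k
  ... | yes s≡k = inj₁ (sym s≡k)
  ... | no  s≢k = inj₂ (punchOut s≢k , sym (punchIn-punchOut s≢k))

  lookup-topple-≡ : ∀ u t → lookup (topple t u) t ≡ lookup u t ∸ deg (ι t) + e (ι t) (ι t)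
  lookup-topple-≡ u t rewrite lookup∘tabulate
    (λ j → if does (j ≟ t) then lookup u t ∸ deg (ι t) + e (ι t) (ι t) else lookup u j + e (ι t) (ι j)) t
    | dec-true (t ≟ t) refl = refl

  lookup-topple-≢ : ∀ u {t i} → i ≢ t → lookup (topple t u) i ≡ lookup u i + e (ι t) (ι i)
  lookup-topple-≢ u {t} {i} i≢t rewrite lookup∘tabulate
    (λ j → if does (j ≟ t) then lookup u t ∸ deg (ι t) + e (ι t) (ι t) else lookup u j + e (ι t) (ι j)) i
    | dec-false (i ≟ t) i≢t = refl

  config-ext : ∀ {u v : Config} → (∀ i → lookup u i ≡ lookup v i) → u ≡ v
  config-ext {u} {v} eq =
    trans (sym (tabulate∘lookup u)) (trans (tabulate-cong eq) (tabulate∘lookup v))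

  -- Instability makes the truncated subtraction of `deg (ι t)` exact, so it commutes with adding
  -- grains.
  topple-⊞ : ∀ {u t} w → ¬ StableAt u t → topple t (u ⊞ w) ≡ topple t u ⊞ w
  topple-⊞ {u} {t} w unstable = config-ext λ i →
    trans (pointwise i) (sym (lookup-zipWith _+_ i (topple t u) w))
    where
    open ≡-Reasoning
    swapʳ : ∀ a b c → a + b + c ≡ a + c + b
    swapʳ = ℕ-Solver.solve-∀
    pointwise : ∀ i → lookup (topple t (u ⊞ w)) i ≡ lookup (topple t u) i + lookup w i
    pointwise i with i ≟ t
    ... | yes refl = begin
      lookup (topple t (u ⊞ w)) t
        ≡⟨ lookup-topple-≡ (u ⊞ w) t ⟩
      lookup (u ⊞ w) t ∸ deg (ι t) + e (ι t) (ι t)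
        ≡⟨ cong (λ x → x ∸ deg (ι t) + e (ι t) (ι t)) (lookup-zipWith _+_ t u w) ⟩
      lookup u t + lookup w t ∸ deg (ι t) + e (ι t) (ι t)
        ≡⟨ cong (_+ e (ι t) (ι t)) (ℕₚ.+-∸-comm (lookup w t) (ℕₚ.≮⇒≥ unstable)) ⟩
      lookup u t ∸ deg (ι t) + lookup w t + e (ι t) (ι t)
        ≡⟨ swapʳ (lookup u t ∸ deg (ι t)) (lookup w t) (e (ι t) (ι t)) ⟩
      lookup u t ∸ deg (ι t) + e (ι t) (ι t) + lookup w t
        ≡⟨ cong (_+ lookup w t) (sym (lookup-topple-≡ u t)) ⟩
      lookup (topple t u) t + lookup w t ∎
    ... | no i≢t = begin
      lookup (topple t (u ⊞ w)) i
        ≡⟨ lookup-topple-≢ (u ⊞ w) i≢t ⟩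
      lookup (u ⊞ w) i + e (ι t) (ι i)
        ≡⟨ cong (_+ e (ι t) (ι i)) (lookup-zipWith _+_ i u w) ⟩
      lookup u i + lookup w i + e (ι t) (ι i)
        ≡⟨ swapʳ (lookup u i) (lookup w i) (e (ι t) (ι i)) ⟩
      lookup u i + e (ι t) (ι i) + lookup w i
        ≡⟨ cong (_+ lookup w i) (sym (lookup-topple-≢ u i≢t)) ⟩
      lookup (topple t u) i + lookup w i ∎

  unstable-⊞ : ∀ {u t} w → ¬ StableAt u t → ¬ StableAt (u ⊞ w) t
  unstable-⊞ {u} {t} w unstable stable = unstable (ℕₚ.≤-<-trans
    (ℕₚ.m≤m+n (lookup u t) (lookup w t))
    (subst (_< deg (ι t)) (lookup-zipWith _+_ t u w) stable))

  -- Extra grains keep every toppled vertex unstable, so the same toppling sequence stays legal.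
  ⟶*-⊞ : ∀ {u v} w → u ⟶* v → u ⊞ w ⟶* v ⊞ w
  ⟶*-⊞ w ε = ε
  ⟶*-⊞ {u} w ((t , unstable , refl) ◅ r) =
    (t , unstable-⊞ {u} w unstable , sym (topple-⊞ {u} w unstable)) ◅ ⟶*-⊞ w r

  -- From any `v`, adding the `w` that leads to `r` and carrying `u` along reaches `r ⊞ u`, which
  -- the given run takes to `c`. Hence the witness `w ⊞ u`.
  recurrent-absorbs : ∀ {r u c} → Recurrent r → u ⊞ r ↝ c → Recurrent c
  recurrent-absorbs {r} {u} {c} rec (u⊞r⟶*c , stable) v with rec v
  ... | w , v⊞w⟶*r , _ = w ⊞ u , subst (_⟶* c) (zipWith-assoc ℕₚ.+-assoc v w u)
    (⟶*-⊞ u v⊞w⟶*r ◅◅ subst (_⟶* c) (zipWith-comm ℕₚ.+-comm u r) u⊞r⟶*c) , stable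

  -- Forbidden subconfigurations

  -- Vertex sets are Boolean predicates, so that they can switch the terms of a sum on and off. The
  -- default `z` is the zero of the summation in use, in ℕ or ℤ.
  restrict : ∀ {A : Set} → (V → Bool) → A → (V → A) → V → A
  restrict F z f k = if F k then f k else z

  restrict-∈ : ∀ {A : Set} {F : V → Bool} {z : A} {f k} → F k ≡ true → restrict F z f k ≡ f k
  restrict-∈ Fk rewrite Fk = refl

  restrict-∉ : ∀ {A : Set} {F : V → Bool} {z : A} {f k} → F k ≡ false → restrict F z f k ≡ z
  restrict-∉ Fk rewrite Fk = refl

  degIn : (V → Bool) → V → ℕ
  degIn F i = Sumℕ.sum (restrict F 0 (e i))

  deg-split : ∀ F i → deg i ≡ degIn F i + degIn (not ∘ F) i
  deg-split F i = sumℕ-split (restrict F 0 (e i)) (restrict (not ∘ F) 0 (e i)) split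
    where
    split : ∀ k → e i k ≡ restrict F 0 (e i) k + restrict (not ∘ F) 0 (e i) k
    split k with F k
    ... | true  = sym (ℕₚ.+-identityʳ _)
    ... | false = refl

  -- Dhar's condition in positive form: a forbidden `F` would be nonempty, avoid the sink and hold
  -- fewer than `degIn F` grains at each of its vertices. Loops count towards `degIn F`, matching
  -- the grains that a toppling returns to its own vertex.
  NoForbidden : Config → Set
  NoForbidden u = ∀ F → F s ≡ false → ∃[ j ] F (ι j) ≡ true →
                  ∃[ i ] F (ι i) ≡ true × degIn F (ι i) ≤ lookup u i

  remove : (V → Bool) → V → V → Bool
  remove F t k = F k ∧ not (does (k ≟ t))

  remove-self : ∀ F t → remove F t t ≡ false
  remove-self F t rewrite dec-true (t ≟ t) refl with F t
  ... | true  = refl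
  ... | false = refl

  remove-other : ∀ F {t k} → k ≢ t → remove F t k ≡ F k
  remove-other F {t} {k} k≢t rewrite dec-false (k ≟ t) k≢t with F k
  ... | true  = refl
  ... | false = refl

  remove⇒≢ : ∀ F {t k} → remove F t k ≡ true → k ≢ t
  remove⇒≢ F {t} r refl with trans (sym r) (remove-self F t)
  ... | ()

  degIn-remove : ∀ F {t} i → F t ≡ true → degIn F i ≡ degIn (remove F t) i + e i t
  degIn-remove F {t} i Ft = trans (sumℕ-split (restrict (remove F t) 0 (e i)) only split)
    (cong (ℕ._+_ (degIn (remove F t) i)) (trans (sumℕ-single only t only-≢) only-≡))
    where
    only : V → ℕ
    only k = if does (k ≟ t) then e i k else 0
    only-≡ : only t ≡ e i t
    only-≡ rewrite dec-true (t ≟ t) refl = refl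
    only-≢ : ∀ k → k ≢ t → only k ≡ 0
    only-≢ k k≢t rewrite dec-false (k ≟ t) k≢t = refl
    split : ∀ k → restrict F 0 (e i) k ≡ restrict (remove F t) 0 (e i) k + only k
    split k with k ≟ t
    ... | yes refl rewrite Ft = refl
    ... | no _ with F k
    ...   | true  = sym (ℕₚ.+-identityʳ _)
    ...   | false = refl

  -- If t topples, a vertex of F that passes for F ∖ {t} passes for F after
  -- receiving the e_{t,i} grains; if F ∖ {t} is empty, t keeps its loops.
  NoForbidden-topple : ∀ {u t} → NoForbidden u → ¬ StableAt u t → NoForbidden (topple t u)
  NoForbidden-topple {u} {t} noF unstable F Fs (j , Fj) with F (ι t) in Ft
  -- A toppling outside `F` only adds grains to vertices of `F`.
  ... | false with noF F Fs (j , Fj)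
  ...   | i , Fi , le = i , Fi , ℕₚ.≤-trans le
            (subst (lookup u i ≤_) (sym (lookup-topple-≢ u i≢t)) (ℕₚ.m≤m+n _ _))
    where
    i≢t : i ≢ t
    i≢t refl with trans (sym Fi) Ft
    ... | ()
  NoForbidden-topple {u} {t} noF unstable F Fs (j , Fj) | true
    with any? (λ i → remove F (ι t) (ι i) Bool.≟ true)
  ... | yes nonempty with noF (remove F (ι t)) (trans (remove-other F (ι≢s t ∘ sym)) Fs) nonempty
  ...   | i , F∖tᵢ , le = i , trans (sym (remove-other F ιi≢ιt)) F∖tᵢ , (begin
            degIn F (ι i)                                ≡⟨ degIn-remove F (ι i) Ft ⟩
            degIn (remove F (ι t)) (ι i) + e (ι i) (ι t) ≤⟨ ℕₚ.+-monoˡ-≤ _ le ⟩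
            lookup u i + e (ι i) (ι t)                   ≡⟨ cong (ℕ._+_ (lookup u i)) (e-sym (ι i) (ι t)) ⟩
            lookup u i + e (ι t) (ι i)                   ≡⟨ lookup-topple-≢ u (ιi≢ιt ∘ cong ι) ⟨
            lookup (topple t u) i                        ∎)
    where
    open ℕₚ.≤-Reasoning
    ιi≢ιt : ι i ≢ ι t
    ιi≢ιt = remove⇒≢ F F∖tᵢ
  NoForbidden-topple {u} {t} noF unstable F Fs (j , Fj) | true | no empty = t , Ft , (begin
    degIn F (ι t)                                ≡⟨ sumℕ-single _ (ι t) outside ⟩
    restrict F 0 (e (ι t)) (ι t)                 ≡⟨ restrict-∈ {F = F} {f = e (ι t)} Ft ⟩
    e (ι t) (ι t)                                ≤⟨ ℕₚ.m≤n+m _ _ ⟩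
    lookup u t ∸ deg (ι t) + e (ι t) (ι t)       ≡⟨ lookup-topple-≡ u t ⟨
    lookup (topple t u) t                        ∎)
    where
    open ℕₚ.≤-Reasoning
    outside : ∀ k → k ≢ ι t → restrict F 0 (e (ι t)) k ≡ 0
    outside k k≢ with sink-or-ι k
    ... | inj₁ refl = restrict-∉ {F = F} {f = e (ι t)} Fs
    ... | inj₂ (i , refl) with F (ι i) in Fi
    ...   | true  = contradiction (i , trans (remove-other F k≢) Fi) empty
    ...   | false = refl

  NoForbidden-⟶* : ∀ {u v} → NoForbidden u → u ⟶* v → NoForbidden v
  NoForbidden-⟶* noF ε = noF
  NoForbidden-⟶* {u} noF ((t , unstable , refl) ◅ r) =
    NoForbidden-⟶* (NoForbidden-topple {u} noF unstable) r

  -- Recurrence is tested on the configuration with `deg` grains everywhere: whatever is added to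
  -- it, each vertex of each `F` holds at least its `degIn F`, and topplings preserve the condition
  -- down to `c`.
  recurrent⇒NoForbidden : ∀ {c} → Recurrent c → NoForbidden c
  recurrent⇒NoForbidden rec with rec (tabulate (deg ∘ ι))
  ... | w , r , _ = NoForbidden-⟶* start r
    where
    start : NoForbidden (tabulate (deg ∘ ι) ⊞ w)
    start F _ (j , Fj) = j , Fj , (begin
      degIn F (ι j)                              ≤⟨ ℕₚ.m≤m+n _ _ ⟩
      degIn F (ι j) + degIn (not ∘ F) (ι j)      ≡⟨ deg-split F (ι j) ⟨
      deg (ι j)                                 ≤⟨ ℕₚ.m≤m+n _ _ ⟩
      deg (ι j) + lookup w j                    ≡⟨ cong (_+ lookup w j) (lookup∘tabulate (deg ∘ ι) j) ⟨
      lookup (tabulate (deg ∘ ι)) j + lookup w j ≡⟨ lookup-zipWith _+_ j (tabulate (deg ∘ ι)) w ⟨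
      lookup (tabulate (deg ∘ ι) ⊞ w) j         ∎)
      where open ℕₚ.≤-Reasoning

  recurrent⇒stable : ∀ {c} → Recurrent c → Stable c
  recurrent⇒stable {c} rec = proj₂ (proj₂ (rec c))

  -- Laplacian

  flow : (V → ℤ) → V → V → ℤ
  flow N i k = + e i k ℤ.* (N i ℤ.- N k)

  -- A loop contributes a multiple of `N i - N i`, hence zero, in agreement with `topple`, which
  -- gives loop grains back.
  laplacian : (V → ℤ) → V → ℤ
  laplacian N i = Sumℤ.sum (flow N i)

  laplacian-+ : ∀ N M i → laplacian (λ k → N k ℤ.+ M k) i ≡ laplacian N i ℤ.+ laplacian M i
  laplacian-+ N M i = sumℤ-split (flow N i) (flow M i) λ k → distrib (+ e i k) (N i) (M i) (N k) (M k)
    where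
    distrib : ∀ x a b c d → x ℤ.* ((a ℤ.+ b) ℤ.- (c ℤ.+ d)) ≡ x ℤ.* (a ℤ.- c) ℤ.+ x ℤ.* (b ℤ.- d)
    distrib = solve-∀

  laplacian-neg : ∀ N i → laplacian (λ k → ℤ.- N k) i ≡ ℤ.- laplacian N i
  laplacian-neg N i = trans (Sumℤ.sum-cong-≗ λ k → negate (+ e i k) (N i) (N k)) (sumℤ-neg (flow N i))
    where
    negate : ∀ x a c → x ℤ.* (ℤ.- a ℤ.- ℤ.- c) ≡ ℤ.- (x ℤ.* (a ℤ.- c))
    negate = solve-∀

  infix 4 _∼_
  -- `N` plays the role of the net number of topplings; negative values are allowed because the
  -- contribution of the identity gets subtracted later. The sink is not compared, as configurations
  -- have no entry there.
  _∼_ : Config → Config → Set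
  u ∼ c = Σ[ N ∈ (V → ℤ) ] (N s ≡ 0ℤ ×
          (∀ i → + lookup u i ℤ.- + lookup c i ≡ laplacian N (ι i)))

  ∼-refl : ∀ {u} → u ∼ u
  ∼-refl {u} = (λ _ → 0ℤ) , refl , λ i → trans (ℤₚ.+-inverseʳ (+ lookup u i))
    (sym (sum-zero ℤₚ.+-0-commutativeMonoid λ k → ℤₚ.*-zeroʳ (+ e (ι i) k)))

  ∼-trans : ∀ {u v w} → u ∼ v → v ∼ w → u ∼ w
  ∼-trans {u} {v} {w} (N , Ns , eqN) (M , Ms , eqM) =
    (λ k → N k ℤ.+ M k) , cong₂ ℤ._+_ Ns Ms , λ i → begin
      + lookup u i ℤ.- + lookup w i
        ≡⟨ telescope (+ lookup u i) (+ lookup v i) (+ lookup w i) ⟩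
      (+ lookup u i ℤ.- + lookup v i) ℤ.+ (+ lookup v i ℤ.- + lookup w i)
        ≡⟨ cong₂ ℤ._+_ (eqN i) (eqM i) ⟩
      laplacian N (ι i) ℤ.+ laplacian M (ι i)
        ≡⟨ laplacian-+ N M (ι i) ⟨
      laplacian (λ k → N k ℤ.+ M k) (ι i) ∎
    where
    open ≡-Reasoning
    telescope : ∀ x y z → x ℤ.- z ≡ (x ℤ.- y) ℤ.+ (y ℤ.- z)
    telescope = solve-∀

  indicator : V → V → ℤ
  indicator a k = if does (k ≟ a) then 1ℤ else 0ℤ

  indicator-≡ : ∀ a → indicator a a ≡ 1ℤ
  indicator-≡ a rewrite dec-true (a ≟ a) refl = refl

  indicator-≢ : ∀ {a k} → k ≢ a → indicator a k ≡ 0ℤ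
  indicator-≢ {a} {k} k≢a rewrite dec-false (k ≟ a) k≢a = refl

  -- `deg` counts each loop once, whereas loops drop out of the Laplacian. The additive form can be
  -- substituted for `deg` in the toppling rule.
  laplacian-indicator-≡ : ∀ a → laplacian (indicator a) a ℤ.+ + e a a ≡ + deg a
  laplacian-indicator-≡ a = begin
    laplacian (indicator a) a ℤ.+ + e a a
      ≡⟨ cong (ℤ._+_ (laplacian (indicator a) a)) (sym single) ⟩
    laplacian (indicator a) a ℤ.+ Sumℤ.sum (λ k → + e a k ℤ.* indicator a k)
      ≡⟨ sumℤ-split (flow (indicator a) a) (λ k → + e a k ℤ.* indicator a k) split ⟨
    Sumℤ.sum (λ k → + e a k)
      ≡⟨ sumℤ-pos (e a) ⟩
    + deg a ∎
    where
    open ≡-Reasoning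
    complement : ∀ x y → x ≡ x ℤ.* (1ℤ ℤ.- y) ℤ.+ x ℤ.* y
    complement = solve-∀
    split : ∀ k → + e a k ≡ flow (indicator a) a k ℤ.+ + e a k ℤ.* indicator a k
    split k rewrite indicator-≡ a = complement (+ e a k) (indicator a k)
    single : Sumℤ.sum (λ k → + e a k ℤ.* indicator a k) ≡ + e a a
    single = trans
      (sumℤ-single _ a λ k k≢a → trans (cong (ℤ._*_ (+ e a k)) (indicator-≢ k≢a)) (ℤₚ.*-zeroʳ (+ e a k)))
      (trans (cong (ℤ._*_ (+ e a a)) (indicator-≡ a)) (ℤₚ.*-identityʳ (+ e a a)))

  laplacian-indicator-≢ : ∀ {a i} → i ≢ a → laplacian (indicator a) i ≡ ℤ.- + e i a
  laplacian-indicator-≢ {a} {i} i≢a = trans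
    (sumℤ-single _ a λ k k≢a → trans
      (cong (ℤ._*_ (+ e i k)) (cong₂ ℤ._-_ (indicator-≢ i≢a) (indicator-≢ k≢a)))
      (ℤₚ.*-zeroʳ (+ e i k)))
    (trans (cong (ℤ._*_ (+ e i a)) (cong₂ ℤ._-_ (indicator-≢ i≢a) (indicator-≡ a)))
      (trans (ℤₚ.*-comm (+ e i a) ℤ.-1ℤ) (ℤₚ.-1*i≡-i (+ e i a))))

  -- One toppling at `t` corresponds to `N` being the indicator of `ι t`. Instability again makes
  -- the subtraction exact.
  topple-∼ : ∀ {u t} → ¬ StableAt u t → u ∼ topple t u
  topple-∼ {u} {t} unstable = indicator (ι t) , indicator-≢ (ι≢s t ∘ sym) , difference
    where
    open ≡-Reasoning
    difference : ∀ i → + lookup u i ℤ.- + lookup (topple t u) i ≡ laplacian (indicator (ι t)) (ι i)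
    difference i with i ≟ t
    ... | yes refl = begin
      + lookup u t ℤ.- + lookup (topple t u) t
        ≡⟨ cong₂ (λ x y → + x ℤ.- + y) (sym (ℕₚ.m∸n+n≡m (ℕₚ.≮⇒≥ unstable))) (lookup-topple-≡ u t) ⟩
      (+ (lookup u t ∸ deg (ι t)) ℤ.+ + deg (ι t)) ℤ.- (+ (lookup u t ∸ deg (ι t)) ℤ.+ + e (ι t) (ι t))
        ≡⟨ cong (λ d → (+ (lookup u t ∸ deg (ι t)) ℤ.+ d) ℤ.- (+ (lookup u t ∸ deg (ι t)) ℤ.+ + e (ι t) (ι t)))
             (laplacian-indicator-≡ (ι t)) ⟨
      (+ (lookup u t ∸ deg (ι t)) ℤ.+ (laplacian (indicator (ι t)) (ι t) ℤ.+ + e (ι t) (ι t)))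
        ℤ.- (+ (lookup u t ∸ deg (ι t)) ℤ.+ + e (ι t) (ι t))
        ≡⟨ cancel (+ (lookup u t ∸ deg (ι t))) (laplacian (indicator (ι t)) (ι t)) (+ e (ι t) (ι t)) ⟩
      laplacian (indicator (ι t)) (ι t) ∎
      where
      cancel : ∀ x y z → (x ℤ.+ (y ℤ.+ z)) ℤ.- (x ℤ.+ z) ≡ y
      cancel = solve-∀
    ... | no i≢t = begin
      + lookup u i ℤ.- + lookup (topple t u) i
        ≡⟨ cong (λ y → + lookup u i ℤ.- + y) (lookup-topple-≢ u i≢t) ⟩
      + lookup u i ℤ.- (+ lookup u i ℤ.+ + e (ι t) (ι i))
        ≡⟨ cancel (+ lookup u i) (+ e (ι t) (ι i)) ⟩
      ℤ.- + e (ι t) (ι i)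
        ≡⟨ cong (λ x → ℤ.- + x) (e-sym (ι t) (ι i)) ⟩
      ℤ.- + e (ι i) (ι t)
        ≡⟨ laplacian-indicator-≢ (i≢t ∘ punchIn-injective s i t) ⟨
      laplacian (indicator (ι t)) (ι i) ∎
      where
      cancel : ∀ x y → x ℤ.- (x ℤ.+ y) ≡ ℤ.- y
      cancel = solve-∀

  ⟶*⇒∼ : ∀ {u v} → u ⟶* v → u ∼ v
  ⟶*⇒∼ {u} ε = ∼-refl {u}
  ⟶*⇒∼ {u} {v} ((t , unstable , refl) ◅ r) =
    ∼-trans {u} {topple t u} {v} (topple-∼ {u} unstable) (⟶*⇒∼ r)

  -- An identity element is itself a Laplacian image, as 𝐞 ⊞ 𝐞 ∼ 𝐞.
  ∼-identity : ∀ {𝐞 u c} → IsSandpileIdentity 𝐞 → u ⊞ 𝐞 ∼ c → u ∼ c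
  ∼-identity {𝐞} {u} {c} (rec , unit) (N , Ns , eqN) with ⟶*⇒∼ (proj₁ (proj₁ (unit 𝐞 rec)))
  ... | M , Ms , eqM = (λ k → N k ℤ.+ ℤ.- M k) , cong₂ (λ x y → x ℤ.+ ℤ.- y) Ns Ms , λ i → begin
      + lookup u i ℤ.- + lookup c i
        ≡⟨ regroup (+ lookup u i) (+ lookup 𝐞 i) (+ lookup c i) ⟩
      ((+ lookup u i ℤ.+ + lookup 𝐞 i) ℤ.- + lookup c i)
        ℤ.+ ℤ.- ((+ lookup 𝐞 i ℤ.+ + lookup 𝐞 i) ℤ.- + lookup 𝐞 i)
        ≡⟨ cong₂ (λ x y → (+ x ℤ.- + lookup c i) ℤ.+ ℤ.- (+ y ℤ.- + lookup 𝐞 i))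
             (lookup-zipWith _+_ i u 𝐞) (lookup-zipWith _+_ i 𝐞 𝐞) ⟨
      (+ lookup (u ⊞ 𝐞) i ℤ.- + lookup c i) ℤ.+ ℤ.- (+ lookup (𝐞 ⊞ 𝐞) i ℤ.- + lookup 𝐞 i)
        ≡⟨ cong₂ (λ x y → x ℤ.+ ℤ.- y) (eqN i) (eqM i) ⟩
      laplacian N (ι i) ℤ.+ ℤ.- laplacian M (ι i)
        ≡⟨ cong (ℤ._+_ (laplacian N (ι i))) (laplacian-neg M (ι i)) ⟨
      laplacian N (ι i) ℤ.+ laplacian (λ k → ℤ.- M k) (ι i)
        ≡⟨ laplacian-+ N (λ k → ℤ.- M k) (ι i) ⟨
      laplacian (λ k → N k ℤ.+ ℤ.- M k) (ι i) ∎
    where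
    open ≡-Reasoning
    regroup : ∀ x y z → x ℤ.- z ≡ ((x ℤ.+ y) ℤ.- z) ℤ.+ ℤ.- ((y ℤ.+ y) ℤ.- y)
    regroup = solve-∀

  -- The flow inside F cancels by antisymmetry, leaving the flow out of F.
  divergence : ∀ N F →
    Sumℤ.sum (restrict F 0ℤ (laplacian N)) ≡
    Sumℤ.sum (restrict F 0ℤ λ i → Sumℤ.sum (restrict (not ∘ F) 0ℤ (flow N i)))
  divergence N F = begin
    Sumℤ.sum (restrict F 0ℤ (laplacian N))
      ≡⟨ sumℤ-split (λ i → Sumℤ.sum (inner i)) outer split ⟩
    Sumℤ.sum (λ i → Sumℤ.sum (inner i)) ℤ.+ Sumℤ.sum outer
      ≡⟨ cong (ℤ._+ Sumℤ.sum outer) (sumℤ-antisym inner anti) ⟩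
    0ℤ ℤ.+ Sumℤ.sum outer
      ≡⟨ ℤₚ.+-identityˡ _ ⟩
    Sumℤ.sum outer ∎
    where
    open ≡-Reasoning
    inner : V → V → ℤ
    inner i k = if F i ∧ F k then flow N i k else 0ℤ
    outer : V → ℤ
    outer = restrict F 0ℤ λ i → Sumℤ.sum (restrict (not ∘ F) 0ℤ (flow N i))
    flow-anti : ∀ i k → flow N i k ≡ ℤ.- flow N k i
    flow-anti i k rewrite e-sym i k = swap (+ e k i) (N i) (N k)
      where
      swap : ∀ x a b → x ℤ.* (a ℤ.- b) ≡ ℤ.- (x ℤ.* (b ℤ.- a))
      swap = solve-∀
    anti : ∀ i k → inner i k ≡ ℤ.- inner k i
    anti i k with F i | F k
    ... | true  | true  = flow-anti i k
    ... | true  | false = refl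
    ... | false | true  = refl
    ... | false | false = refl
    split : ∀ i → restrict F 0ℤ (laplacian N) i ≡ Sumℤ.sum (inner i) ℤ.+ outer i
    split i with F i
    ... | true = sumℤ-split (λ k → if F k then flow N i k else 0ℤ) (restrict (not ∘ F) 0ℤ (flow N i)) case-F
      where
      case-F : ∀ k → flow N i k ≡ (if F k then flow N i k else 0ℤ) ℤ.+ restrict (not ∘ F) 0ℤ (flow N i) k
      case-F k with F k
      ... | true  = sym (ℤₚ.+-identityʳ _)
      ... | false = sym (ℤₚ.+-identityˡ _)
    ... | false = sym (trans (ℤₚ.+-identityʳ _) (sum-zero ℤₚ.+-0-commutativeMonoid {n = suc m} λ _ → refl))

-- Paths and parents in the tree.

module Tree {m : ℕ} (T : ThickTree m) where
  open DecMembership (_≟_ {suc m}) using (_∈?_)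
  open ThickTree T
  open Toppling graph

  Adj-sym : ∀ {i j} → Adj i j → Adj j i
  Adj-sym {i} {j} (i≢j , eᵢⱼ≢0) = i≢j ∘ sym , eᵢⱼ≢0 ∘ trans (e-sym i j)

  source∈ : ∀ {i j} (w : Walk i j) → i ∈ vertices w
  source∈ ε       = here refl
  source∈ (_ ◅ _) = here refl

  cons-path : ∀ {i j k} (a : Adj i j) (w : Walk j k) → i ∉ vertices w → IsPath w → IsPath (a ◅ w)
  cons-path _ _ i∉w path = ¬Any⇒All¬ _ i∉w ∷ path

  suffix : ∀ {i j k} (w : Walk j k) → IsPath w → i ∈ vertices w →
           Σ[ w′ ∈ Walk i k ] (IsPath w′ × vertices w′ ⊆ vertices w)
  suffix ε       path       (here refl) = ε , path , λ x∈ → x∈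
  suffix (a ◅ w) path       (here refl) = a ◅ w , path , λ x∈ → x∈
  suffix (_ ◅ w) (_ ∷ path) (there i∈w) with suffix w path i∈w
  ... | w′ , path′ , w′⊆w = w′ , path′ , there ∘ w′⊆w

  -- Avoidance of `x` is built into the step relation, so that it survives concatenation and
  -- reversal of walks.
  AdjOff : V → V → V → Set
  AdjOff x i j = Adj i j × x ≢ i × x ≢ j

  walk-off : ∀ {x i j} (w : Walk i j) → x ∉ vertices w → Star (AdjOff x) i j
  walk-off ε       x∉w = ε
  walk-off (a ◅ w) x∉w =
    (a , x∉w ∘ here , λ { refl → x∉w (there (source∈ w)) }) ◅ walk-off w (x∉w ∘ there)

  -- Loop erasure: if the new source already lies on the path, the path is cut back to its suffix
  -- from there, which visits no new vertex and so still avoids `x`.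
  path-off : ∀ {x i j} → x ≢ i → Star (AdjOff x) i j →
             Σ[ w ∈ Walk i j ] (IsPath w × x ∉ vertices w)
  path-off x≢i ε = ε , [] ∷ [] , λ { (here x≡i) → x≢i x≡i }
  path-off {i = i} x≢i ((a , _ , x≢j) ◅ w) with path-off x≢j w
  ... | w′ , path , x∉w′ with i ∈? vertices w′
  ...   | no i∉w′ = a ◅ w′ , cons-path a w′ i∉w′ path ,
                    λ { (here x≡i) → x≢i x≡i ; (there x∈w′) → x∉w′ x∈w′ }
  ...   | yes i∈w′ with suffix w′ path i∈w′
  ...     | w″ , path″ , w″⊆w′ = w″ , path″ , x∉w′ ∘ w″⊆w′

  -- Two distinct neighbours of i that reach the sink off i would close a
  -- cycle through i.
  branch-unique : ∀ {i a b} → Adj i a → Adj i b →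
                  (v : Walk a s) → i ∉ vertices v → (w : Walk b s) → i ∉ vertices w → a ≡ b
  branch-unique {i} {a} {b} i~a i~b v i∉v w i∉w = join (path-off (proj₁ i~a)
    (walk-off v i∉v ◅◅ reverse (λ (x~y , i≢x , i≢y) → Adj-sym x~y , i≢y , i≢x) (walk-off w i∉w)))
    where
    nonempty : ∀ {j k} (w : Walk j k) → 1 ≤ length (vertices w)
    nonempty ε       = s≤s z≤n
    nonempty (_ ◅ _) = s≤s z≤n
    join : Σ[ w ∈ Walk a b ] (IsPath w × i ∉ vertices w) → a ≡ b
    join (ε , _) = refl
    -- A nonempty walk has at least two vertices; with `i` in front there are the three that a cycle
    -- requires, and the edge from `b` to `i` closes it.
    join (w@(_ ◅ q) , path , i∉w) = contradiction (Adj-sym i~b)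
      (acyclic (i~a ◅ w) (cons-path i~a w i∉w path) (s≤s (s≤s (nonempty q))))

  ⪰-refl : ∀ j → ι j ⪰ ι j
  ⪰-refl j with proj₂ (hasParent connected j)
  ... | _ , (w , path , _) , _ = w , path , source∈ w

  -- A nonempty walk from the sink to itself repeats the sink, so only the trivial one is a path.
  sink⋡ : ∀ j → ¬ (s ⪰ ι j)
  sink⋡ j (ε , _ , here ιj≡s) = ι≢s j ιj≡s
  sink⋡ j (a ◅ w , path ∷ _ , _) = contradiction refl (All.lookup path (target∈ w))
    where
    target∈ : ∀ {i j} (w : Walk i j) → j ∈ vertices w
    target∈ ε       = here refl
    target∈ (_ ◅ w) = there (target∈ w)

  adj-parent : ∀ j → Adj (ι j) (parent j)
  adj-parent j = proj₁ (proj₂ (hasParent connected j))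

  -- A path does not return to its source, so any suffix starting later misses `j`.
  proper-suffix : ∀ {i j k} → j ≢ i → (w : Walk j k) → IsPath w → i ∈ vertices w →
                  Σ[ w′ ∈ Walk i k ] (IsPath w′ × j ∉ vertices w′)
  proper-suffix j≢i ε       _            (here i≡j)  = contradiction (sym i≡j) j≢i
  proper-suffix j≢i (_ ◅ w) _            (here i≡j)  = contradiction (sym i≡j) j≢i
  proper-suffix j≢i (_ ◅ w) (off ∷ path) (there i∈w) with suffix w path i∈w
  ... | w′ , path′ , w′⊆w = w′ , path′ , All¬⇒¬Any off ∘ w′⊆w

  parent-walk : ∀ j → Σ[ w ∈ Walk (parent j) s ] ι j ∉ vertices w
  parent-walk j with proj₂ (hasParent connected j)
  ... | _ , (w , path , p∈w) , ιj≢p with proper-suffix ιj≢p w path p∈w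
  ...   | w′ , _ , ιj∉w′ = w′ , ιj∉w′

  -- `parent` is read off one chosen path; comparing that path with an arbitrary walk by
  -- `branch-unique` removes the choice.
  parent-unique : ∀ {j k} → Adj (ι j) k → (w : Walk k s) → ι j ∉ vertices w → k ≡ parent j
  parent-unique {j} j~k w ιj∉w =
    branch-unique j~k (adj-parent j) w ιj∉w (proj₁ (parent-walk j)) (proj₂ (parent-walk j))

  -- Otherwise a path from the parent would have a suffix from `ι j` to the sink that misses the
  -- parent. But the first step of that suffix must go to the parent, by `parent-unique`.
  parent⋡ : ∀ j → ¬ (parent j ⪰ ι j)
  parent⋡ j (w , path , ιj∈w) with proper-suffix (proj₁ (adj-parent j) ∘ sym) w path ιj∈w
  ... | v , path′ , p∉v = through-parent refl v path′ p∉v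
    where
    through-parent : ∀ {x} → x ≡ ι j → (v : Walk x s) → IsPath v → ¬ (parent j ∉ vertices v)
    through-parent s≡ιj ε       _         _   = ι≢s j (sym s≡ιj)
    through-parent x≡ιj (a ◅ v) (off ∷ _) p∉v = p∉v (there (subst (_∈ vertices v)
      (parent-unique (subst (λ x → Adj x _) x≡ιj a) v (subst (_∉ vertices v) x≡ιj (All¬⇒¬Any off)))
      (source∈ v)))

  -- Take a path from `i` to the sink through `ι j`. If `k` were off it, prepending `k` would give
  -- `k ⪰ ι j`. So `k` is on it, and by `branch-unique` it is the vertex right after `i`. Were `ι j`
  -- on the remaining path, again `k ⪰ ι j`; hence `i` is `ι j` and `k` its parent.
  exit-edge : ∀ {i j k} → i ⪰ ι j → ¬ (k ⪰ ι j) → e i k ≢ 0 → i ≡ ι j × k ≡ parent j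
  exit-edge {i} {j} {k} i⪰j k⋡j eᵢₖ≢0 = exit i⪰j
    where
    i≢k : i ≢ k
    i≢k refl = k⋡j i⪰j
    i~k : Adj i k
    i~k = i≢k , eᵢₖ≢0
    exit : i ⪰ ι j → i ≡ ι j × k ≡ parent j
    exit (w , path , j∈w) with k ∈? vertices w
    ... | no k∉w = contradiction
          (Adj-sym i~k ◅ w , cons-path (Adj-sym i~k) w k∉w path , there j∈w) k⋡j
    exit (ε , _ , _)     | yes (here k≡i) = contradiction (sym k≡i) i≢k
    exit (a ◅ w , _ , _) | yes (here k≡i) = contradiction (sym k≡i) i≢k
    exit (a ◅ w , off ∷ path , j∈) | yes (there k∈w) with suffix w path k∈w
    ... | v , _ , v⊆w
      with branch-unique i~k a v (All¬⇒¬Any off ∘ v⊆w) w (All¬⇒¬Any off) | j∈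
    ...   | refl | there j∈w = contradiction (w , path , j∈w) k⋡j
    ...   | refl | here refl = refl , parent-unique i~k w (All¬⇒¬Any off)

  -- Subtrees and the edges leaving them.

  opaque
    -- Opaque, so that the path search behind `_⪰?_` is never unfolded; later arguments go through
    -- `subtree⁺` and `subtree⁻`.
    subtree : V₀ → V → Bool
    subtree j k = does (k ⪰? ι j)

    subtree⁺ : ∀ {j k} → k ⪰ ι j → subtree j k ≡ true
    subtree⁺ {j} {k} = dec-true (k ⪰? ι j)

    subtree⁻ : ∀ {j k} → ¬ (k ⪰ ι j) → subtree j k ≡ false
    subtree⁻ {j} {k} = dec-false (k ⪰? ι j)

  subtree⇒⪰ : ∀ {j k} → subtree j k ≡ true → k ⪰ ι j
  subtree⇒⪰ {j} {k} k∈ with k ⪰? ι j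
  ... | yes k⪰j = k⪰j
  ... | no  k⋡j with trans (sym k∈) (subtree⁻ k⋡j)
  ...   | ()

  -- This is `exit-edge` in summable form: it kills all but one term of a sum over the complement.
  -- It is generic in `f` to cover both edge counts and flows.
  exits-at-parent : ∀ {A : Set} {z : A} {f i j} → (∀ k → e i k ≡ 0 → f k ≡ z) → i ⪰ ι j →
                    ∀ k → ¬ (i ≡ ι j × k ≡ parent j) → restrict (not ∘ subtree j) z f k ≡ z
  exits-at-parent {z = z} {f} {i} {j} f≡z i⪰j k not-parent with k ⪰? ι j
  ... | yes k⪰j = restrict-∉ {F = not ∘ subtree j} {f = f} (cong not (subtree⁺ k⪰j))
  ... | no k⋡j with e i k ℕₚ.≟ 0
  ...   | yes e≡0 = trans (restrict-∈ {F = not ∘ subtree j} {f = f} (cong not (subtree⁻ k⋡j))) (f≡z k e≡0)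
  ...   | no  e≢0 = contradiction (exit-edge i⪰j k⋡j e≢0) not-parent

  parent∈complement : ∀ {A : Set} {z : A} {f j} → restrict (not ∘ subtree j) z f (parent j) ≡ f (parent j)
  parent∈complement {f = f} {j} = restrict-∈ {F = not ∘ subtree j} {f = f} (cong not (subtree⁻ (parent⋡ j)))

  -- The subtree of `j` contains a vertex `i` holding at least its degree within the subtree. For
  -- `i ≢ j` no edge leaves the subtree at `i`, so that degree is all of `deg (ι i)`, against
  -- stability. Hence `i` is `j`, which loses only the `eₚ j` edges to its parent.
  recurrent-lower : ∀ {c} → Recurrent c → ∀ j → deg (ι j) ≤ lookup c j + eₚ j
  recurrent-lower {c} rec j
    with recurrent⇒NoForbidden rec (subtree j) (subtree⁻ (sink⋡ j)) (j , subtree⁺ (⪰-refl j))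
  ... | i , i∈ , le with i ≟ j
  ...   | yes refl = begin
    deg (ι j)
      ≡⟨ deg-split (subtree j) (ι j) ⟩
    degIn (subtree j) (ι j) + degIn (not ∘ subtree j) (ι j)
      ≡⟨ cong (ℕ._+_ (degIn (subtree j) (ι j)))
           (trans (sumℕ-single _ (parent j) λ k k≢p → exits-at-parent (λ _ e≡0 → e≡0) (⪰-refl j) k (k≢p ∘ proj₂))
                  (parent∈complement {f = e (ι j)})) ⟩
    degIn (subtree j) (ι j) + eₚ j
      ≤⟨ ℕₚ.+-monoˡ-≤ (eₚ j) le ⟩
    lookup c j + eₚ j ∎
    where open ℕₚ.≤-Reasoning
  ...   | no i≢j =
    contradiction (ℕₚ.≤-<-trans (subst (_≤ lookup c i) full le) (recurrent⇒stable rec i)) (ℕₚ.n≮n _)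
    where
    full : degIn (subtree j) (ι i) ≡ deg (ι i)
    full = sym (trans (deg-split (subtree j) (ι i)) (trans
      (cong (ℕ._+_ (degIn (subtree j) (ι i))) (sum-zero ℕₚ.+-0-commutativeMonoid λ k →
        exits-at-parent (λ _ e≡0 → e≡0) (subtree⇒⪰ i∈) k (i≢j ∘ punchIn-injective s i j ∘ proj₁)))
      (ℕₚ.+-identityʳ _)))

  -- Summing the Laplacian over a subtree.

  subtree-excess : ∀ u c j →
    Sumℤ.sum (λ i → if subtree j (ι i) then + lookup u i ℤ.- + lookup c i else 0ℤ) ≡
    (+ lookup u j ℤ.- + lookup c j) ℤ.+ excess u c j
  subtree-excess u c j = trans (sumℤ-split only (λ i → if does (ι i ≻? ι j) then d i else 0ℤ) split)
    (cong (ℤ._+ excess u c j) (trans (sumℤ-single only j only-≢) only-≡))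
    where
    d : V₀ → ℤ
    d i = + lookup u i ℤ.- + lookup c i
    only : V₀ → ℤ
    only i = if does (i ≟ j) then d i else 0ℤ
    only-≡ : only j ≡ d j
    only-≡ rewrite dec-true (j ≟ j) refl = refl
    only-≢ : ∀ i → i ≢ j → only i ≡ 0ℤ
    only-≢ i i≢j rewrite dec-false (i ≟ j) i≢j = refl
    split : ∀ i → (if subtree j (ι i) then d i else 0ℤ) ≡
                  only i ℤ.+ (if does (ι i ≻? ι j) then d i else 0ℤ)
    split i = by-cases (i ≟ j) (ι i ⪰? ι j)
      where
      if-d : Bool → ℤ
      if-d b = if b then d i else 0ℤ
      by-cases : Dec (i ≡ j) → Dec (ι i ⪰ ι j) →
                 if-d (subtree j (ι i)) ≡ only i ℤ.+ if-d (does (ι i ≻? ι j))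
      by-cases (yes refl) _ = trans (cong if-d (subtree⁺ (⪰-refl j))) (sym (trans
        (cong₂ ℤ._+_ only-≡ (cong if-d (dec-false (ι j ≻? ι j) λ (_ , j≢j) → j≢j refl)))
        (ℤₚ.+-identityʳ (d j))))
      by-cases (no i≢j) (yes i⪰j) = trans (cong if-d (subtree⁺ i⪰j)) (sym (trans
        (cong₂ ℤ._+_ (only-≢ i i≢j)
          (cong if-d (dec-true (ι i ≻? ι j) (i⪰j , i≢j ∘ punchIn-injective s i j))))
        (ℤₚ.+-identityˡ (d i))))
      by-cases (no i≢j) (no i⋡j) = trans (cong if-d (subtree⁻ i⋡j)) (sym
        (cong₂ ℤ._+_ (only-≢ i i≢j) (cong if-d (dec-false (ι i ≻? ι j) (i⋡j ∘ proj₁)))))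

  subtree-flow : ∀ {u c} ((N , _) : u ∼ c) j →
    (+ lookup u j ℤ.- + lookup c j) ℤ.+ excess u c j ≡ flow N (ι j) (parent j)
  subtree-flow {u} {c} (N , _ , eq) j = begin
    (+ lookup u j ℤ.- + lookup c j) ℤ.+ excess u c j
      ≡⟨ subtree-excess u c j ⟨
    Sumℤ.sum (λ i → if F (ι i) then + lookup u i ℤ.- + lookup c i else 0ℤ)
      ≡⟨ Sumℤ.sum-cong-≗ (λ i → cong (λ x → if F (ι i) then x else 0ℤ) (eq i)) ⟩
    Sumℤ.sum (restrict F 0ℤ (laplacian N) ∘ ι)
      -- The sink lies outside the subtree, so a zero term for it extends the sum from `V₀` to `V`,
      -- where `divergence` applies.
      ≡⟨ ℤₚ.+-identityˡ _ ⟨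
    0ℤ ℤ.+ Sumℤ.sum (restrict F 0ℤ (laplacian N) ∘ ι)
      ≡⟨ cong (ℤ._+ Sumℤ.sum (restrict F 0ℤ (laplacian N) ∘ ι))
           (restrict-∉ {F = F} {f = laplacian N} (subtree⁻ (sink⋡ j))) ⟨
    restrict F 0ℤ (laplacian N) s ℤ.+ Sumℤ.sum (restrict F 0ℤ (laplacian N) ∘ ι)
      ≡⟨ Sumℤ.sum-remove {i = s} (restrict F 0ℤ (laplacian N)) ⟨
    Sumℤ.sum (restrict F 0ℤ (laplacian N))
      ≡⟨ divergence N F ⟩
    Sumℤ.sum (restrict F 0ℤ outflow)
      -- Of the outflow, only the edges from `ι j` to its parent remain.
      ≡⟨ sumℤ-single _ (ι j) inside ⟩
    restrict F 0ℤ outflow (ι j)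
      ≡⟨ restrict-∈ {F = F} {f = outflow} (subtree⁺ (⪰-refl j)) ⟩
    outflow (ι j)
      ≡⟨ sumℤ-single _ (parent j) (λ k k≢p → exits-at-parent (no-edge (ι j)) (⪰-refl j) k (k≢p ∘ proj₂)) ⟩
    restrict (not ∘ F) 0ℤ (flow N (ι j)) (parent j)
      ≡⟨ parent∈complement {f = flow N (ι j)} ⟩
    flow N (ι j) (parent j) ∎
    where
    open ≡-Reasoning
    F : V → Bool
    F = subtree j
    outflow : V → ℤ
    outflow i = Sumℤ.sum (restrict (not ∘ F) 0ℤ (flow N i))
    no-edge : ∀ i k → e i k ≡ 0 → flow N i k ≡ 0ℤ
    no-edge i k e≡0 = cong (λ x → + x ℤ.* (N i ℤ.- N k)) e≡0
    inside : ∀ i → i ≢ ι j → restrict F 0ℤ outflow i ≡ 0ℤ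
    inside i i≢j with F i in Fi
    ... | false = refl
    ... | true  = sum-zero ℤₚ.+-0-commutativeMonoid λ k →
          exits-at-parent (no-edge i) (subtree⇒⪰ Fi) k (i≢j ∘ proj₁)

  -- λ_j is the unique integer that puts c_j into [deg(j) − e_{j,p(j)}, deg(j)).
  nonLeafFormula : ∀ {u c} → Recurrent c → u ∼ c → ∀ j → NonLeafFormula u c j
  nonLeafFormula {u} {c} rec u∼c@(N , _) j = begin
    + lookup c j
      ≡⟨ solve-c (+ lookup u j) (+ lookup c j) (excess u c j) ⟩
    + lookup u j ℤ.+ ℤ.- ((+ lookup u j ℤ.- + lookup c j) ℤ.+ excess u c j) ℤ.+ excess u c j
      ≡⟨ cong (λ x → + lookup u j ℤ.+ ℤ.- x ℤ.+ excess u c j) (subtree-flow {u} {c} u∼c j) ⟩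
    + lookup u j ℤ.+ ℤ.- (+ eₚ j ℤ.* K) ℤ.+ excess u c j
      ≡⟨ cong (λ x → + lookup u j ℤ.+ x ℤ.+ excess u c j) (neg-swap (+ eₚ j) K) ⟩
    + lookup u j ℤ.+ ℤ.- K ℤ.* + eₚ j ℤ.+ excess u c j
      ≡⟨ cong (λ x → + lookup u j ℤ.+ x ℤ.* + eₚ j ℤ.+ excess u c j) λ′≡-K ⟨
    + lookup u j ℤ.+ λ′ u c j ℤ.* + eₚ j ℤ.+ excess u c j ∎
    where
    open ≡-Reasoning
    instance _ = eₚ-nonZero j
    K : ℤ
    K = N (ι j) ℤ.- N (parent j)
    -- The distance of `lookup c j` from its largest stable value, which accounts for the `1ℤ`
    -- subtracted in `λ′`. Being below `eₚ j` by `recurrent-lower`, it is the remainder of the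
    -- division in `λ′`, with quotient `- K`.
    r : ℕ
    r = deg (ι j) ∸ suc (lookup c j)
    deg≡ : suc (lookup c j) + r ≡ deg (ι j)
    deg≡ = ℕₚ.m+[n∸m]≡n (recurrent⇒stable rec j)
    r<eₚ : r < eₚ j
    r<eₚ = ℕₚ.+-cancelˡ-≤ (lookup c j) (suc r) (eₚ j) (subst (_≤ lookup c j + eₚ j)
      (trans (sym deg≡) (sym (ℕₚ.+-suc (lookup c j) r))) (recurrent-lower rec j))
    solve-c : ∀ x y z → y ≡ x ℤ.+ ℤ.- ((x ℤ.- y) ℤ.+ z) ℤ.+ z
    solve-c = solve-∀
    neg-swap : ∀ x y → ℤ.- (x ℤ.* y) ≡ ℤ.- y ℤ.* x
    neg-swap = solve-∀
    rearrange : ∀ x y z r → (1ℤ ℤ.+ y ℤ.+ r) ℤ.- x ℤ.- z ℤ.- 1ℤ ≡ r ℤ.+ ℤ.- ((x ℤ.- y) ℤ.+ z)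
    rearrange = solve-∀
    λ′≡-K : λ′ u c j ≡ ℤ.- K
    λ′≡-K = /ℕ-unique _ (ℤ.- K) r (eₚ j) r<eₚ (begin
      + deg (ι j) ℤ.- + lookup u j ℤ.- excess u c j ℤ.- 1ℤ
        ≡⟨ cong (λ x → + x ℤ.- + lookup u j ℤ.- excess u c j ℤ.- 1ℤ) deg≡ ⟨
      (1ℤ ℤ.+ + lookup c j ℤ.+ + r) ℤ.- + lookup u j ℤ.- excess u c j ℤ.- 1ℤ
        ≡⟨ rearrange (+ lookup u j) (+ lookup c j) (excess u c j) (+ r) ⟩
      + r ℤ.+ ℤ.- ((+ lookup u j ℤ.- + lookup c j) ℤ.+ excess u c j)
        ≡⟨ cong (λ x → + r ℤ.+ ℤ.- x) (subtree-flow {u} {c} u∼c j) ⟩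
      + r ℤ.+ ℤ.- (+ eₚ j ℤ.* K)
        ≡⟨ cong (ℤ._+_ (+ r)) (neg-swap (+ eₚ j) K) ⟩
      + r ℤ.+ ℤ.- K ℤ.* + eₚ j ∎)

  -- Another edge would put a second entry into the one-element list of neighbours. That list does
  -- not see loops, so `k = ι j` is excluded by looplessness.
  leaf-edges : ∀ {j} → IsLeaf j → IsLoopless j → ∀ k → k ≢ parent j → e (ι j) k ≡ 0
  leaf-edges {j} leaf loopless k k≢p with e (ι j) k ℕₚ.≟ 0
  ... | yes e≡0 = e≡0
  ... | no  e≢0 = contradiction
    (length≡1⇒unique leaf
      (∈-filter⁺ (Adj? (ι j)) (∈-allFin k) ((λ { refl → e≢0 loopless }) , e≢0))
      (∈-filter⁺ (Adj? (ι j)) (∈-allFin (parent j)) (adj-parent j)))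
    k≢p

  -- Here the Laplacian at `ι j` has a single term, a multiple of `eₚ j`, and `deg (ι j)` equals
  -- `eₚ j`. Stability therefore makes `lookup c j` the remainder of `lookup u j` modulo `eₚ j`.
  leafFormula : ∀ {u c} → Stable c → u ∼ c → ∀ j → IsLeaf j → IsLoopless j → LeafFormula u c j
  leafFormula {u} {c} stable (N , _ , eq) j leaf loopless = begin
    + lookup c j
      ≡⟨ solve-c (+ lookup u j) (+ lookup c j) ⟩
    + lookup u j ℤ.- (+ lookup u j ℤ.- + lookup c j)
      ≡⟨ cong (λ x → + lookup u j ℤ.- x) u-c≡ ⟩
    + lookup u j ℤ.- K ℤ.* + eₚ j
      ≡⟨ cong (λ x → + lookup u j ℤ.- x ℤ.* + eₚ j) quotient ⟨
    -- On a nonnegative integer `_/ℕ_` computes to division in ℕ, as in `LeafFormula`.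
    + lookup u j ℤ.- (+ lookup u j /ℕ eₚ j) ℤ.* + eₚ j ∎
    where
    open ≡-Reasoning
    instance _ = eₚ-nonZero j
    K : ℤ
    K = N (ι j) ℤ.- N (parent j)
    solve-c : ∀ x y → y ≡ x ℤ.- (x ℤ.- y)
    solve-c = solve-∀
    restore : ∀ x y → x ≡ y ℤ.+ (x ℤ.- y)
    restore = solve-∀
    deg≡eₚ : deg (ι j) ≡ eₚ j
    deg≡eₚ = sumℕ-single (e (ι j)) (parent j) (leaf-edges leaf loopless)
    u-c≡ : + lookup u j ℤ.- + lookup c j ≡ K ℤ.* + eₚ j
    u-c≡ = trans (eq j) (trans
      (sumℤ-single (flow N (ι j)) (parent j) λ k k≢p →
        cong (λ x → + x ℤ.* (N (ι j) ℤ.- N k)) (leaf-edges leaf loopless k k≢p))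
      (ℤₚ.*-comm (+ eₚ j) K))
    quotient : + lookup u j /ℕ eₚ j ≡ K
    quotient = /ℕ-unique _ K (lookup c j) (eₚ j) (subst (lookup c j <_) deg≡eₚ (stable j))
      (trans (restore (+ lookup u j) (+ lookup c j)) (cong (ℤ._+_ (+ lookup c j)) u-c≡))

  recursiveFormula : ∀ {u c} → Recurrent c → u ∼ c → RecursiveFormula u c
  recursiveFormula {u} {c} rec u∼c j =
    (λ (leaf , loopless) → leafFormula {u} {c} (recurrent⇒stable rec) u∼c j leaf loopless) ,
    (λ _ → nonLeafFormula {u} {c} rec u∼c j)

corollary3p5 : ∀ {m : ℕ} (T : ThickTree m) → let open ThickTree T in
    ∀ (u : Config) →
    (∀ (𝐞 : Config) → IsSandpileIdentity 𝐞 →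
    ∀ (c : Config) → u ⊞ 𝐞 ↝ c → Recurrent c × RecursiveFormula u c)
    × (∀ (c : Config) → u ↝ c → Recurrent c → RecursiveFormula u c)
corollary3p5 T u =
  (λ 𝐞 identity c u⊞𝐞↝c →
    let rec = recurrent-absorbs {u = u} (proj₁ identity) u⊞𝐞↝c in
    rec , recursiveFormula {u} {c} rec (∼-identity {u = u} {c} identity (⟶*⇒∼ (proj₁ u⊞𝐞↝c)))) ,
  (λ c u↝c rec → recursiveFormula {u} {c} rec (⟶*⇒∼ (proj₁ u↝c)))
  where
  open Toppling (ThickTree.graph T)
  open Tree T
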